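{- We have $C_{Q_5,\mathbf 1}=6$.
   Context: $\mathbb Z_5=\mathbb Z/5\mathbb Z$ and $Q_5=\{1,-1\}$ is the set of non-zero squares in $\mathbb Z_5$. A sequence of length $k$ in $\mathbb Z_5$ is an element of $\mathbb Z_5^k$. A sequence $(x_1,\ldots,x_k)$ in $\mathbb Z_5$ is called a $(Q_5,\mathbf 1)$-weighted zero-sum sequence if there exist $a_1,\ldots,a_k\in Q_5$ such that $a_1x_1+\cdots+a_kx_k=0$ and $a_1+\cdots+a_k=0$ in $\mathbb Z_5$. The constant $C_{Q_5,\mathbf 1}$ is the least positive integer $k$ such that every sequence in $\mathbb Z_5$ of length $k$ has a (non-empty) $(Q_5,\mathbf 1)$-weighted zero-sum subsequence consisting of consecutive terms. -}

module Defs where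

open import Data.Fin using (Fin; toℕ)
open import Data.Fin.Patterns using (0F)
open import Data.Nat as ℕ using (ℕ; _≤_; _<_)
open import Data.Nat.DivMod using (_mod_)
open import Data.List.Relation.Binary.Infix.Heterogeneous using (Infix)
open import Data.Product using (∃-syntax; Σ-syntax; _×_)
open import Data.Vec using (Vec; foldr′; toList; zipWith)
open import Data.Vec.Relation.Unary.All using (All)
open import Relation.Binary.PropositionalEquality using (_≡_; _≢_)

-- Residue classes are represented by their least non-negative representatives;
-- in particular -1 is 4F.
ℤ₅ : Set
ℤ₅ = Fin 5

infixl 6 _+_
infixl 7 _*_

_+_ : ℤ₅ → ℤ₅ → ℤ₅
x + y = (toℕ x ℕ.+ toℕ y) mod 5

_*_ : ℤ₅ → ℤ₅ → ℤ₅
x * y = (toℕ x ℕ.* toℕ y) mod 5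

Q₅ : ℤ₅ → Set
Q₅ x = x ≢ 0F × ∃[ y ] x ≡ y * y

Sequence : ℕ → Set
Sequence k = Vec ℤ₅ k

sum : ∀ {k} → Sequence k → ℤ₅
sum = foldr′ _+_ 0F

-- The 𝟏 in (Q₅,𝟏) is the constant sequence of ones: the same weights must also
-- annihilate it, which is the second equation.
WeightedZeroSum : ∀ {k} → Sequence k → Set
WeightedZeroSum {k} xs =
  Σ[ as ∈ Sequence k ] All Q₅ as × sum (zipWith _*_ as xs) ≡ 0F × sum as ≡ 0F

-- Infix _≡_ says that the first list is a contiguous block of the second.
HasConsecutiveZeroSum : ∀ {k} → Sequence k → Set
HasConsecutiveZeroSum xs =
  ∃[ m ] Σ[ ys ∈ Sequence m ]
    0 < m × Infix _≡_ (toList ys) (toList xs) × WeightedZeroSum ys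

EverySequenceHas : ℕ → Set
EverySequenceHas k = (xs : Sequence k) → HasConsecutiveZeroSum xs

-- The constant C_{Q₅,𝟏} is k. Being the least element of a set of naturals,
-- such a k is unique, so this relation stands for the equation.
C[Q₅,𝟏]≡_ : ℕ → Set
C[Q₅,𝟏]≡ k =
  0 < k × EverySequenceHas k × (∀ j → 0 < j → EverySequenceHas j → k ≤ j)

{-# OPTIONS --safe #-}

-- Upper bound: split x₁ … x₆ into three consecutive pairs with differences d, e, f
-- and weight each pair by (1,-1) or (-1,1). The weights then sum to zero, and the
-- weighted sum is a signed sum of differences, so it suffices to find a signed zero
-- sum on a block of d, e, f. If d, e, f are non-zero and d ≠ ±e, e ≠ ±f, then their
-- squares are ±1 with d² = f² = -e², so e = ±2d, f = ±d and d ± e ± f = 0 for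
-- suitable signs.
--
-- Lower bound: 0, 1, 0, 2, 0 has no consecutive zero-sum block, and the property
-- passes from a length to every greater one.
module Submission where

open import Data.Bool using (Bool; true; false; not)
open import Data.Fin.Patterns using (0F; 1F; 2F; 3F; 4F)
open import Data.Fin.Properties using (_≟_; all?; any?)
open import Data.Fin.Subset.Properties using (anySubset?)
open import Data.List using (List; []; _∷_)
open import Data.List.Relation.Binary.Infix.Heterogeneous using (Infix; here; there)
open import Data.List.Relation.Binary.Prefix.Heterogeneous using (Prefix; []; _∷_)
open import Data.Nat as ℕ using (suc; _<_; _≤′_; z<s)
open import Data.Nat.Properties using (≰⇒>; ≤⇒≤′)
open import Data.Product using (∃-syntax; Σ-syntax; _×_; _,_)
open import Data.Sum using (_⊎_; inj₁; inj₂; [_,_]′)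
open import Data.Vec using (Vec; []; _∷_; map; toList; zipWith)
open import Data.Vec.Relation.Unary.All using (All; []; _∷_)
open import Relation.Binary.PropositionalEquality
  using (_≡_; refl; trans; cong)
open import Relation.Nullary using (Dec; no; ¬_; contradiction)
open import Relation.Nullary.Decidable
  using (from-yes; from-no; map′; _×-dec_; _⊎-dec_)

open import Defs

-- Booleans encode the weights so that a choice of weights is a `Vec Bool k`, the form that
-- `anySubset?` searches exhaustively.
sign : Bool → ℤ₅
sign true  = 1F
sign false = 4F

sign∈Q₅ : ∀ b → Q₅ (sign b)
sign∈Q₅ true  = (λ ()) , 1F , refl
sign∈Q₅ false = (λ ()) , 2F , refl

Q₅⇒sign : ∀ {x} → Q₅ x → ∃[ b ] sign b ≡ x
Q₅⇒sign {0F} (x≢0 , _) = contradiction refl x≢0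
Q₅⇒sign {1F} _         = true , refl
Q₅⇒sign {2F} (_ , sq)  = contradiction sq (from-no (any? λ y → 2F ≟ y * y))
Q₅⇒sign {3F} (_ , sq)  = contradiction sq (from-no (any? λ y → 3F ≟ y * y))
Q₅⇒sign {4F} _         = false , refl

signs∈Q₅ : ∀ {k} (bs : Vec Bool k) → All Q₅ (map sign bs)
signs∈Q₅ []       = []
signs∈Q₅ (b ∷ bs) = sign∈Q₅ b ∷ signs∈Q₅ bs

Q₅⇒signs : ∀ {k} {as : Sequence k} → All Q₅ as → ∃[ bs ] map sign bs ≡ as
Q₅⇒signs []       = [] , refl
Q₅⇒signs (q ∷ qs) with Q₅⇒sign q | Q₅⇒signs qs
... | b , refl | bs , refl = b ∷ bs , refl

SignedZeroSum : ∀ {k} → Sequence k → Set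
SignedZeroSum {k} ds = Σ[ bs ∈ Vec Bool k ] sum (zipWith _*_ (map sign bs) ds) ≡ 0F

signedZeroSum? : ∀ {k} (ds : Sequence k) → Dec (SignedZeroSum ds)
signedZeroSum? ds = anySubset? λ bs → sum (zipWith _*_ (map sign bs) ds) ≟ 0F

difference : ℤ₅ × ℤ₅ → ℤ₅
difference (x , y) = x + 4F * y

flatten : ∀ {n} → Vec (ℤ₅ × ℤ₅) n → Sequence (n ℕ.* 2)
flatten []             = []
flatten ((x , y) ∷ ps) = x ∷ y ∷ flatten ps

alternate : ∀ {n} → Vec Bool n → Vec Bool (n ℕ.* 2)
alternate []       = []
alternate (b ∷ bs) = b ∷ not b ∷ alternate bs

sum-alternate : ∀ {n} (bs : Vec Bool n) → sum (map sign (alternate bs)) ≡ 0F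
sum-alternate []           = refl
sum-alternate (true  ∷ bs) = cong (λ z → 1F + (4F + z)) (sum-alternate bs)
sum-alternate (false ∷ bs) = cong (λ z → 4F + (1F + z)) (sum-alternate bs)

-- Once `b` is fixed the weights are literals, and all 125 triples are checked; `z` stands for the
-- remaining sum.
weighted-pair : ∀ b x y z →
  sign b * x + (sign (not b) * y + z) ≡ sign b * difference (x , y) + z
weighted-pair true = from-yes (all? λ x → all? λ y → all? λ z →
  1F * x + (4F * y + z) ≟ 1F * (x + 4F * y) + z)
weighted-pair false = from-yes (all? λ x → all? λ y → all? λ z →
  4F * x + (1F * y + z) ≟ 4F * (x + 4F * y) + z)

sum-flatten : ∀ {n} (bs : Vec Bool n) (ps : Vec (ℤ₅ × ℤ₅) n) →
  sum (zipWith _*_ (map sign (alternate bs)) (flatten ps))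
    ≡ sum (zipWith _*_ (map sign bs) (map difference ps))
sum-flatten []       []             = refl
sum-flatten (b ∷ bs) ((x , y) ∷ ps) = trans
  (cong (λ z → sign b * x + (sign (not b) * y + z)) (sum-flatten bs ps))
  (weighted-pair b x y _)

flatten-weightedZeroSum : ∀ {n} (ps : Vec (ℤ₅ × ℤ₅) n) →
  SignedZeroSum (map difference ps) → WeightedZeroSum (flatten ps)
flatten-weightedZeroSum ps (bs , eq) =
  map sign (alternate bs) , signs∈Q₅ (alternate bs) ,
  trans (sum-flatten bs ps) eq , sum-alternate bs

-- Decided over all 125 triples. The pair `d`, `f` is absent because its terms are not adjacent.
consecutive-signedZeroSum : ∀ d e f →
  SignedZeroSum (d ∷ []) ⊎ SignedZeroSum (e ∷ []) ⊎ SignedZeroSum (f ∷ []) ⊎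
  SignedZeroSum (d ∷ e ∷ []) ⊎ SignedZeroSum (e ∷ f ∷ []) ⊎
  SignedZeroSum (d ∷ e ∷ f ∷ [])
consecutive-signedZeroSum = from-yes (all? λ d → all? λ e → all? λ f →
  signedZeroSum? (d ∷ []) ⊎-dec signedZeroSum? (e ∷ []) ⊎-dec
  signedZeroSum? (f ∷ []) ⊎-dec signedZeroSum? (d ∷ e ∷ []) ⊎-dec
  signedZeroSum? (e ∷ f ∷ []) ⊎-dec signedZeroSum? (d ∷ e ∷ f ∷ []))

-- With index `suc n` the length `suc n * 2` reduces to a successor, so `z<s` shows the block
-- non-empty.
block : ∀ {k n} {xs : Sequence k} (ps : Vec (ℤ₅ × ℤ₅) (suc n)) →
  Infix _≡_ (toList (flatten ps)) (toList xs) →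
  SignedZeroSum (map difference ps) → HasConsecutiveZeroSum xs
block ps inf s = _ , flatten ps , z<s , inf , flatten-weightedZeroSum ps s

everySequenceHas-6 : EverySequenceHas 6
everySequenceHas-6 (x₁ ∷ x₂ ∷ x₃ ∷ x₄ ∷ x₅ ∷ x₆ ∷ []) =
  -- Each skipped pair costs two `there`s.
  [ block (p ∷ []) (here (refl ∷ refl ∷ []))
  , [ block (q ∷ []) (there (there (here (refl ∷ refl ∷ []))))
  , [ block (r ∷ []) (there (there (there (there (here (refl ∷ refl ∷ []))))))
  , [ block (p ∷ q ∷ []) (here (refl ∷ refl ∷ refl ∷ refl ∷ []))
  , [ block (q ∷ r ∷ []) (there (there (here (refl ∷ refl ∷ refl ∷ refl ∷ []))))
  , block (p ∷ q ∷ r ∷ []) (here (refl ∷ refl ∷ refl ∷ refl ∷ refl ∷ refl ∷ []))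
  ]′ ]′ ]′ ]′ ]′ (consecutive-signedZeroSum (difference p) (difference q) (difference r))
  where
  p q r : ℤ₅ × ℤ₅
  p = x₁ , x₂
  q = x₃ , x₄
  r = x₅ , x₆

weightedZeroSum? : ∀ {k} (xs : Sequence k) → Dec (WeightedZeroSum xs)
weightedZeroSum? xs = map′
  (λ (bs , eqs) → map sign bs , signs∈Q₅ bs , eqs)
  (λ (as , qs , eqs) → fromSigns (Q₅⇒signs qs) eqs)
  (anySubset? λ bs →
    (sum (zipWith _*_ (map sign bs) xs) ≟ 0F) ×-dec (sum (map sign bs) ≟ 0F))
  where
  fromSigns : ∀ {as} → ∃[ bs ] map sign bs ≡ as →
    sum (zipWith _*_ as xs) ≡ 0F × sum as ≡ 0F →
    ∃[ bs ] sum (zipWith _*_ (map sign bs) xs) ≡ 0F × sum (map sign bs) ≡ 0F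
  fromSigns (bs , refl) eqs = bs , eqs

module _ {A : Set} where

  -- A prefix is empty or starts with the head `x`; in the latter case the recursion absorbs `x`
  -- into the predicate.
  anyPrefix? : {P : ∀ {m} → Vec A m → Set} →
    (∀ {m} (ys : Vec A m) → Dec (P ys)) → (xs : List A) →
    Dec (∃[ m ] Σ[ ys ∈ Vec A m ] Prefix _≡_ (toList ys) xs × P ys)
  anyPrefix? {P} P? [] = map′
    (λ p → _ , [] , [] , p) (λ { (_ , [] , [] , p) → p }) (P? [])
  anyPrefix? {P} P? (x ∷ xs) = map′
    (λ { (inj₁ p)                 → _ , [] , [] , p
       ; (inj₂ (_ , _ , pre , p)) → _ , _ , refl ∷ pre , p })
    (λ { (_ , [] , [] , p)             → inj₁ p
       ; (_ , _ ∷ ys , refl ∷ pre , p) → inj₂ (_ , ys , pre , p) })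
    (P? [] ⊎-dec anyPrefix? {λ ys → P (x ∷ ys)} (λ ys → P? (x ∷ ys)) xs)

  anyInfix? : {P : ∀ {m} → Vec A m → Set} →
    (∀ {m} (ys : Vec A m) → Dec (P ys)) → (xs : List A) →
    Dec (∃[ m ] Σ[ ys ∈ Vec A m ] 0 < m × Infix _≡_ (toList ys) xs × P ys)
  anyInfix? {P} P? [] = no λ { (_ , _ ∷ _ , _ , here () , _) }
  anyInfix? {P} P? (x ∷ xs) = map′
    (λ { (inj₁ (_ , _ , pre , p))       → _ , _ , z<s , here (refl ∷ pre) , p
       ; (inj₂ (_ , _ , 0<m , inf , p)) → _ , _ , 0<m , there inf , p })
    -- A block starting at the head is `x` followed by a prefix of the tail, since `0 < m` rules out
    -- the empty block.
    (λ { (_ , _ ∷ ys , _ , here (refl ∷ pre) , p) → inj₁ (_ , ys , pre , p)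
       ; (_ , ys , 0<m , there inf , p)           → inj₂ (_ , ys , 0<m , inf , p) })
    (anyPrefix? {λ ys → P (x ∷ ys)} (λ ys → P? (x ∷ ys)) xs ⊎-dec anyInfix? {P} P? xs)

hasConsecutiveZeroSum? : ∀ {k} (xs : Sequence k) → Dec (HasConsecutiveZeroSum xs)
hasConsecutiveZeroSum? xs = anyInfix? {P = WeightedZeroSum} weightedZeroSum? (toList xs)

-- Weights ±1 on at most five terms cancel modulo 5 only for lengths 2 and 4, or for length 5 with
-- all weights equal. The weighted sums are then ±1 or ±2, ±1 ± 2, and ±3 respectively, never 0.
¬everySequenceHas-5 : ¬ EverySequenceHas 5
¬everySequenceHas-5 every =
  from-no (hasConsecutiveZeroSum? (0F ∷ 1F ∷ 0F ∷ 2F ∷ 0F ∷ []))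
    (every (0F ∷ 1F ∷ 0F ∷ 2F ∷ 0F ∷ []))

everySequenceHas-suc : ∀ {k} → EverySequenceHas k → EverySequenceHas (suc k)
everySequenceHas-suc every (x ∷ xs) with every xs
... | m , ys , 0<m , inf , zs = m , ys , 0<m , there inf , zs

everySequenceHas-mono : ∀ {j k} → j ≤′ k → EverySequenceHas j → EverySequenceHas k
everySequenceHas-mono (ℕ.≤′-reflexive refl) every = every
everySequenceHas-mono (ℕ.≤′-step j≤k)       every =
  everySequenceHas-suc (everySequenceHas-mono j≤k every)

theorem3p9 : C[Q₅,𝟏]≡ 6
-- `6 ≤ j` unfolds from `5 < j`, so it suffices to refute `j ≤ 5`.
theorem3p9 = z<s , everySequenceHas-6 , λ j _ every → ≰⇒> λ j≤5 →
  ¬everySequenceHas-5 (everySequenceHas-mono (≤⇒≤′ j≤5) every)
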